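{- Let $k\ge1$ be the cache size and let $N\ge k+1$. For the path access graph $P_N$ on $N$ vertices and $\mathcal{A}\in\{\mathrm{LRU},\mathrm{FAR}\}$, \[ \mathcal{I}^{P_N}[\mathrm{FWF},\mathcal{A}]=\left[0,\ 1-\frac{1}{k}\right]. \] Moreover, for $\mathcal{A}=\mathrm{LRU}$ the same equality $\mathcal{I}^{G}[\mathrm{FWF},\mathrm{LRU}]=[0,1-\frac1k]$ holds for any access graph $G$ containing a path on $k+1$ vertices.
   Context: Paging: a cache holds at most $k$ pages and is initially empty. A request to a page in the cache is a hit; otherwise it is a fault, the page is brought into the cache, evicting a page first if the cache is full. $\mathcal{A}(I)$ is the number of faults of $\mathcal{A}$ on request sequence $I$. LRU evicts the least recently requested cached page. FWF (flush-when-full): on a fault with a full cache, it empties the cache and then brings in the requested page. FAR (relative to the access graph): each requested page is marked; on a fault with a full cache, if all cached pages are marked it first unmarks all pages; it then evicts the unmarked cached page whose graph distance to the nearest marked page is largest, ties broken by evicting the least recently requested. Access graph: a graph $G$ whose vertices are the pages; a request sequence respects $G$ if any two consecutive requests are identical or adjacent in $G$; $L(G)$ is the set of such sequences. Relative interval: $\mathrm{Min}_{\mathcal{A},\mathcal{B}}(n,G)=\min\{\mathcal{A}(I)-\mathcal{B}(I): I\in L(G),|I|=n\}$, $\mathrm{Max}_{\mathcal{A},\mathcal{B}}(n,G)$ analogously with max; $\mathrm{Min}^G(\mathcal{A},\mathcal{B})=\liminf_{n\to\infty}\mathrm{Min}_{\mathcal{A},\mathcal{B}}(n,G)/n$, $\mathrm{Max}^G(\mathcal{A},\mathcal{B})=\limsup_{n\to\infty}\mathrm{Max}_{\mathcal{A},\mathcal{B}}(n,G)/n$,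 and $\mathcal{I}^G[\mathcal{A},\mathcal{B}]=[\mathrm{Min}^G(\mathcal{A},\mathcal{B}),\mathrm{Max}^G(\mathcal{A},\mathcal{B})]$. -}

module Defs where

open import Data.Bool.Base using (if_then_else_)
open import Data.Fin.Base using (Fin; toℕ)
open import Data.Fin.Properties using (_≟_; any?)
open import Data.Integer.Base as ℤ using (ℤ; +_)
open import Data.List.Base using (List; []; _∷_; [_]; length; filter; foldr; map; takeWhile; upTo)
open import Data.List.Relation.Unary.All using (all?)
open import Data.List.Relation.Unary.Linked using (Linked)
open import Data.Nat.Base using (ℕ; zero; suc; _⊓_; _≤_)
import Data.Nat.Properties as ℕ
open import Data.Product.Base using (∃-syntax; _×_; _,_; proj₁)
open import Data.Rational.Base as ℚ using (ℚ; 0ℚ)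
open import Data.Sum.Base using (_⊎_; inj₁; inj₂)
open import Function.Definitions using (Injective)
open import Relation.Binary.Core using (Rel)
open import Relation.Binary.Definitions using (Decidable; Symmetric; Irreflexive)
open import Relation.Binary.PropositionalEquality using (_≡_; refl; sym)
open import Relation.Nullary.Decidable using (does; ¬?; map′; _×-dec_; _⊎-dec_)
open import Level using (0ℓ)

import Data.List.Membership.DecPropositional as DecMembership

private
  variable
    N : ℕ

open module Membership {N : ℕ} = DecMembership (_≟_ {N}) using (_∈?_)

------------------------------------------------------------------------
-- Access graphs

-- Finite simple graphs, with vertex set Fin N.
record Graph (N : ℕ) : Set₁ where
  field
    Adj        : Rel (Fin N) 0ℓ
    adj?       : Decidable Adj
    adj-sym    : Symmetric Adj
    adj-irrefl : Irreflexive _≡_ Adj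

open Graph public

path : (N : ℕ) → Graph N
path N .Adj i j = toℕ j ≡ suc (toℕ i) ⊎ toℕ i ≡ suc (toℕ j)
path N .adj? i j = (toℕ j ℕ.≟ suc (toℕ i)) ⊎-dec (toℕ i ℕ.≟ suc (toℕ j))
path N .adj-sym (inj₁ e) = inj₂ e
path N .adj-sym (inj₂ e) = inj₁ e
path N .adj-irrefl refl (inj₁ e) = ℕ.1+n≢n (sym e)
path N .adj-irrefl refl (inj₂ e) = ℕ.1+n≢n (sym e)

-- G contains H as a (not necessarily induced) subgraph.
Contains : ∀ {M} → Graph N → Graph M → Set
Contains {N} {M} G H =
  ∃[ f ] Injective {A = Fin M} {B = Fin N} _≡_ _≡_ f
       × (∀ {u v} → Adj H u v → Adj G (f u) (f v))

data Walk (G : Graph N) : ℕ → Fin N → Fin N → Set where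
  []  : ∀ {u} → Walk G zero u u
  _∷_ : ∀ {d u v w} → Adj G u v → Walk G d v w → Walk G (suc d) u w

walk? : (G : Graph N) (d : ℕ) → Decidable (Walk G d)
walk? G zero    u w = map′ (λ { refl → [] }) (λ { [] → refl }) (u ≟ w)
walk? G (suc d) u w =
  map′ (λ { (_ , a , p) → a ∷ p }) (λ { (a ∷ p) → _ , a , p })
       (any? λ v → adj? G u v ×-dec walk? G d v w)

-- The least d with a walk of length d from u to w.  Finite distances are at
-- most N - 1, and the value N represents an infinite distance.
distance : Graph N → Fin N → Fin N → ℕ
distance {N} G u w = length (takeWhile (λ d → ¬? (walk? G d u w)) (upTo N))

distanceTo : Graph N → List (Fin N) → Fin N → ℕ
distanceTo {N} G ws u = foldr _⊓_ N (map (distance G u) ws)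

------------------------------------------------------------------------
-- Paging algorithms

record Algorithm (N : ℕ) : Set₁ where
  field
    State   : Set
    initial : State
    cache   : State → List (Fin N)
    serve   : Fin N → State → State

open Algorithm public

faultsFrom : (A : Algorithm N) → State A → List (Fin N) → ℕ
faultsFrom A s []      = 0
faultsFrom A s (p ∷ I) =
  if does (p ∈? cache A s)
  then faultsFrom A (serve A p s) I
  else suc (faultsFrom A (serve A p s) I)

faults : Algorithm N → List (Fin N) → ℕ
faults A = faultsFrom A (initial A)

FWF : (k : ℕ) → Algorithm N
FWF k .State   = List (Fin _)
FWF k .initial = []
FWF k .cache c = c
FWF k .serve p c =
  if does (p ∈? c) then c
  else if does (length c ℕ.<? k) then p ∷ c
  else [ p ]

-- For LRU and FAR the cache lists its pages without repetition, from the most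
-- recently to the least recently requested.

remove : Fin N → List (Fin N) → List (Fin N)
remove p = filter (λ q → ¬? (q ≟ p))

dropLast : ∀ {A : Set} → List A → List A
dropLast []           = []
dropLast (x ∷ [])     = []
dropLast (x ∷ y ∷ xs) = x ∷ dropLast (y ∷ xs)

LRU : (k : ℕ) → Algorithm N
LRU k .State   = List (Fin _)
LRU k .initial = []
LRU k .cache c = c
LRU k .serve p c =
  if does (p ∈? c) then p ∷ remove p c
  else if does (length c ℕ.<? k) then p ∷ c
  else p ∷ dropLast c

-- The last entry of x ∷ xs at which f is maximal.
lastArgmax : ∀ {A : Set} → (A → ℕ) → A → List A → A
lastArgmax f x []       = x
lastArgmax f x (y ∷ ys) =
  if does (f x ℕ.≤? f y) then lastArgmax f y ys else lastArgmax f x ys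

-- FAR's eviction from the cache c when ms are the marked pages.  Later entries
-- of c are less recently requested, so lastArgmax breaks ties as required.
-- The case without unmarked pages does not arise in FAR when k ≥ 1.
evictFarthest : Graph N → List (Fin N) → List (Fin N) → List (Fin N)
evictFarthest G ms c with filter (λ q → ¬? (q ∈? ms)) c
... | []     = c
... | q ∷ qs = remove (lastArgmax (distanceTo G ms) q qs) c

-- A state is a cache together with the list of marked pages.  The requested
-- page is itself marked when the page to evict is chosen; in particular it is
-- the only marked page right after all pages have been unmarked.
FAR : (k : ℕ) → Graph N → Algorithm N
FAR k G .State   = List (Fin _) × List (Fin _)
FAR k G .initial = [] , []
FAR k G .cache   = proj₁
FAR k G .serve p (c , ms) =
  if does (p ∈? c) then (p ∷ remove p c , p ∷ ms)
  else if does (length c ℕ.<? k) then (p ∷ c , p ∷ ms)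
  else if does (all? (_∈? ms) c) then (p ∷ evictFarthest G [ p ] c , [ p ])
  else (p ∷ evictFarthest G (p ∷ ms) c , p ∷ ms)

------------------------------------------------------------------------
-- Relative intervals

Respects : Graph N → List (Fin N) → Set
Respects G = Linked (λ p q → p ≡ q ⊎ Adj G p q)

-- The values A(I) - B(I) for I ∈ L(G) with |I| = n.
Difference : (A B : Algorithm N) → Graph N → ℕ → ℤ → Set
Difference A B G n x =
  ∃[ I ] Respects G I × length I ≡ n × x ≡ + faults A I ℤ.- + faults B I

IsMinimum IsMaximum : (ℤ → Set) → ℤ → Set
IsMinimum P m = P m × (∀ x → P x → m ℤ.≤ x)
IsMaximum P m = P m × (∀ x → P x → x ℤ.≤ m)

-- Since ℚ is not complete, limits inferior and superior are relations.
IsLiminf IsLimsup : (ℕ → ℚ) → ℚ → Set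
IsLiminf s l = ∀ ε → 0ℚ ℚ.< ε →
    (∃[ n₀ ] ∀ n → n₀ ≤ n → l ℚ.- ε ℚ.< s n)
  × (∀ n₀ → ∃[ n ] n₀ ≤ n × s n ℚ.< l ℚ.+ ε)
IsLimsup s l = ∀ ε → 0ℚ ℚ.< ε →
    (∃[ n₀ ] ∀ n → n₀ ≤ n → s n ℚ.< l ℚ.+ ε)
  × (∀ n₀ → ∃[ n ] n₀ ≤ n × l ℚ.- ε ℚ.< s n)

-- I^G[A,B] = [lower,upper].  The averages Min(n,G)/n and Max(n,G)/n form
-- sequences starting at n = 1.
record RelativeInterval (G : Graph N) (A B : Algorithm N) (lower upper : ℚ) : Set where
  field
    Min        : ℕ → ℤ
    Max        : ℕ → ℤ
    Min-min    : ∀ n → IsMinimum (Difference A B G n) (Min n)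
    Max-max    : ∀ n → IsMaximum (Difference A B G n) (Max n)
    Min-liminf : IsLiminf (λ n → Min (suc n) ℚ./ suc n) lower
    Max-limsup : IsLimsup (λ n → Max (suc n) ℚ./ suc n) upper

{-# OPTIONS --safe #-}
module Submission where

-- FWF's cache holds the pages requested in its current phase, and LRU and FAR
-- (like every marking algorithm) keep those pages, so they fault at most as often
-- as FWF; a constant sequence attains difference 0. When FWF flushes k pages, the
-- other cache consists of the same pages and faults too. Hence the difference grows by
-- at most k - 1 in a phase, and a complete phase takes at least k requests. Going
-- back and forth along a path of k + 1 vertices attains this rate: FWF faults on every
-- request, whereas LRU and FAR always evict the opposite end of the path and fault only
-- at the two ends.

open import Defs
open Membership using (_∈?_)
open import Data.Bool.Base using (true; false)
open import Data.Fin.Base using (Fin; zero; suc; toℕ; fromℕ; fromℕ<; inject₁; inject≤)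
import Data.Fin.Properties as Fin
open import Data.Integer.Base as ℤ using (ℤ; +_; 0ℤ)
import Data.Integer.Properties as ℤ
open import Data.Integer.Solver using () renaming (module +-*-Solver to ℤSolver)
open import Data.List.Base using
  (List; []; _∷_; [_]; _++_; _∷ʳ_; _ʳ++_; length; filter; replicate; reverse; tabulate;
   takeWhile; applyUpTo; allFin; cartesianProductWith)
open import Data.List.Extrema ℤ.≤-totalOrder using (argmax; argmax-all; f[xs]≤f[argmax])
import Data.List.Properties as List
open import Data.List.Membership.Propositional using (_∈_; _∉_; find)
open import Data.List.Membership.Propositional.Properties using
  (∈-filter⁺; ∈-filter⁻; ∈-++⁺ˡ; ∈-++⁺ʳ; ∈-allFin; ∈-cartesianProductWith⁺; ∈-cartesianProductWith⁻)
open import Data.List.Relation.Binary.Permutation.Propositional using (_↭_; ↭-sym; ↭⇒↭ₛ)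
open import Data.List.Relation.Binary.Permutation.Propositional.Properties using
  (shift; ↭-reverse; ↭-length; ∷↭∷ʳ; All-resp-↭)
import Data.List.Relation.Binary.Permutation.Setoid.Properties as Permutationₛ
open import Data.List.Relation.Binary.Subset.Propositional using (_⊆_)
open import Data.List.Relation.Binary.Subset.Propositional.Properties using (∷⁺ʳ)
open import Data.List.Relation.Unary.All as All using (All; []; _∷_; all?)
import Data.List.Relation.Unary.All.Properties as All
open import Data.List.Relation.Unary.AllPairs as AllPairs using ([]; _∷_)
open import Data.List.Relation.Unary.Any as Any using (here; there)
open import Data.List.Relation.Unary.Linked using (Linked; []; [-]; _∷_; linked?)
open import Data.List.Relation.Unary.Unique.Propositional using (Unique)
import Data.List.Relation.Unary.Unique.Propositional.Properties as Unique
open import Data.Nat.Base using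
  (ℕ; zero; suc; _+_; _*_; _∸_; ∣_-_∣; _≤_; _<_; z≤n; s≤s; NonZero)
import Data.Nat.Properties as ℕ
open import Data.Nat.Solver using () renaming (module +-*-Solver to ℕSolver)
open import Data.Product.Base using (∃-syntax; _×_; _,_; proj₁; proj₂)
open import Data.Rational.Base as ℚ using (0ℚ; 1ℚ; _-_; _/_)
import Data.Rational.Properties as ℚ
open import Data.Rational.Unnormalised.Base as ℚᵘ using (mkℚᵘ; *≡*; *≤*; *<*)
import Data.Rational.Unnormalised.Properties as ℚᵘ
open import Data.Sum.Base using (_⊎_; inj₁; inj₂)
open import Data.Unit.Base using (⊤)
open import Function.Base using (_∘_; id)
open import Relation.Binary.Core using (Rel)
open import Relation.Binary.Definitions using (Symmetric)
open import Relation.Binary.PropositionalEquality hiding ([_])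
open import Relation.Nullary.Decidable using (Dec; yes; no; does; ¬?; dec-true; dec-false; _⊎-dec_)
open import Relation.Nullary.Negation using (¬_; contradiction)
open import Relation.Unary using (Pred; Decidable)
open import Level using (0ℓ)

-- Write `F` and `A` for the faults of FWF and of the other algorithm on `n` requests. Charging `A`
-- only at flushes gives `F ≤ k * A + k`, where the last summand covers the first phase. Adding
-- `k - 1` copies of the trivial bound `F ≤ n` yields `k * (F - A) ≤ (k - 1) * n + k`, so the length
-- of a phase enters only through `F ≤ n`, and the constant disappears in the average. No formula
-- for the maximum is derived. It exists by finite search and is squeezed between this bound and the
-- zigzag, which is evaluated only at lengths divisible by `k`; for a limsup that is enough. LRU
-- decides by recency alone, so any path in `G` supports the zigzag. FAR also looks at distances in
-- all of `G`, where edges off the path could bring its ends closer together. Hence its part needs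
-- the ends to be mutually farthest, which is verified in path graphs.

private
  variable
    N k m n : ℕ
    p q y z : Fin N
    xs ys zs c : List (Fin N)

-- Duplicate-free lists of pages

remove-shorter : p ∈ xs → length (remove p xs) < length xs
remove-shorter {xs = xs} p∈xs =
  List.filter-notAll _ xs (Any.map (λ p≡q q≢p → q≢p (sym p≡q)) p∈xs)

∈-remove⁺ : q ∈ xs → q ≢ p → q ∈ remove p xs
∈-remove⁺ = ∈-filter⁺ _

∈-remove⁻ : ∀ (xs : List (Fin N)) → q ∈ remove p xs → q ∈ xs × q ≢ p
∈-remove⁻ xs = ∈-filter⁻ _ {xs = xs}

∉-remove : ∀ (xs : List (Fin N)) → p ∉ remove p xs
∉-remove xs p∈ = proj₂ (∈-remove⁻ xs p∈) refl

remove-∉ : p ∉ xs → remove p xs ≡ xs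
remove-∉ p∉xs = List.filter-all _ (All.tabulate λ { q∈xs refl → p∉xs q∈xs })

remove-head : ∀ (p : Fin N) xs → remove p (p ∷ xs) ≡ remove p xs
remove-head p xs = List.filter-reject (λ q → ¬? (q Fin.≟ p)) {xs = xs} (λ p≢p → p≢p refl)

remove-no-longer : ∀ (p : Fin N) xs → length (remove p xs) ≤ length xs
remove-no-longer p = List.length-filter (λ q → ¬? (q Fin.≟ p))

∉⇒All-≢ : p ∉ xs → All (p ≢_) xs
∉⇒All-≢ p∉xs = All.tabulate λ { q∈xs refl → p∉xs q∈xs }

_∷ᵘ_ : p ∉ xs → Unique xs → Unique (p ∷ xs)
p∉xs ∷ᵘ uxs = ∉⇒All-≢ p∉xs ∷ uxs

-- Induction on `xs`, deleting its head from `ys`: the tail avoids the head, so it stays contained,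
-- and `ys` gets strictly shorter.
Unique-⊆⇒length≤ : Unique xs → xs ⊆ ys → length xs ≤ length ys
Unique-⊆⇒length≤ [] _ = z≤n
Unique-⊆⇒length≤ (x≢xs ∷ uxs) x∷xs⊆ys = ℕ.≤-trans
  (s≤s (Unique-⊆⇒length≤ uxs λ q∈xs →
    ∈-remove⁺ (x∷xs⊆ys (there q∈xs)) λ { refl → All.lookup x≢xs q∈xs refl }))
  (remove-shorter (x∷xs⊆ys (here refl)))

-- Pigeonhole: a page of `ys` missing from `xs` would extend `xs` to a duplicate-free list inside
-- `ys` that is longer than `ys`.
full-⊆ : Unique xs → xs ⊆ ys → length ys ≤ length xs → ys ⊆ xs
full-⊆ {xs = xs} uxs xs⊆ys ys≤xs {p} p∈ys with p ∈? xs
... | yes p∈xs = p∈xs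
... | no  p∉xs = contradiction
  (ℕ.≤-trans (Unique-⊆⇒length≤ (p∉xs ∷ᵘ uxs) λ { (here refl) → p∈ys ; (there q∈xs) → xs⊆ys q∈xs }) ys≤xs)
  (ℕ.n≮n _)

Unique-resp-↭ : xs ↭ ys → Unique xs → Unique ys
Unique-resp-↭ = Permutationₛ.Unique-resp-↭ (setoid _) ∘ ↭⇒↭ₛ

length-dropLast : ∀ {A : Set} (xs : List A) → length (dropLast xs) ≡ length xs ∸ 1
length-dropLast []           = refl
length-dropLast (x ∷ [])     = refl
length-dropLast (x ∷ y ∷ xs) = cong suc (length-dropLast (y ∷ xs))

dropLast-∷ʳ : ∀ {A : Set} (xs : List A) x → dropLast (xs ∷ʳ x) ≡ xs
dropLast-∷ʳ []           x = refl
dropLast-∷ʳ (y ∷ [])     x = refl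
dropLast-∷ʳ (y ∷ z ∷ xs) x = cong (y ∷_) (dropLast-∷ʳ (z ∷ xs) x)

dropLast-++ : ∀ {A : Set} (xs : List A) {y ys} →
              dropLast (xs ++ y ∷ ys) ≡ xs ++ dropLast (y ∷ ys)
dropLast-++ []           = refl
dropLast-++ (x ∷ [])     = refl
dropLast-++ (x ∷ z ∷ xs) = cong (x ∷_) (dropLast-++ (z ∷ xs))

-- Single requests

module _ (A : Algorithm N) {s : State A} where

  faults-hit : ∀ I → p ∈ cache A s → faultsFrom A s (p ∷ I) ≡ faultsFrom A (serve A p s) I
  faults-hit {p = p} I p∈ rewrite dec-true (p ∈? cache A s) p∈ = refl

  faults-tail : ∀ I → faultsFrom A (serve A p s) I ≤ faultsFrom A s (p ∷ I)
  faults-tail {p = p} I with does (p ∈? cache A s)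
  ... | true  = ℕ.≤-refl
  ... | false = ℕ.n≤1+n _

  faults-miss : ∀ I → p ∉ cache A s → faultsFrom A s (p ∷ I) ≡ suc (faultsFrom A (serve A p s) I)
  faults-miss {p = p} I p∉ rewrite dec-false (p ∈? cache A s) p∉ = refl

FWF-hit : p ∈ c → serve (FWF k) p c ≡ c
FWF-hit {p = p} {c = c} p∈c rewrite dec-true (p ∈? c) p∈c = refl

FWF-insert : p ∉ c → length c < k → serve (FWF k) p c ≡ p ∷ c
FWF-insert {p = p} {c = c} {k = k} p∉c c<k
  rewrite dec-false (p ∈? c) p∉c | dec-true (length c ℕ.<? k) c<k = refl

FWF-flush : p ∉ c → k ≤ length c → serve (FWF k) p c ≡ [ p ]
FWF-flush {p = p} {c = c} {k = k} p∉c k≤c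
  rewrite dec-false (p ∈? c) p∉c | dec-false (length c ℕ.<? k) (ℕ.≤⇒≯ k≤c) = refl

LRU-hit : p ∈ c → serve (LRU k) p c ≡ p ∷ remove p c
LRU-hit {p = p} {c = c} p∈c rewrite dec-true (p ∈? c) p∈c = refl

LRU-insert : p ∉ c → length c < k → serve (LRU k) p c ≡ p ∷ c
LRU-insert {p = p} {c = c} {k = k} p∉c c<k
  rewrite dec-false (p ∈? c) p∉c | dec-true (length c ℕ.<? k) c<k = refl

LRU-evict : p ∉ c → k ≤ length c → serve (LRU k) p c ≡ p ∷ dropLast c
LRU-evict {p = p} {c = c} {k = k} p∉c k≤c
  rewrite dec-false (p ∈? c) p∉c | dec-false (length c ℕ.<? k) (ℕ.≤⇒≯ k≤c) = refl

module _ (G : Graph N) {ms : List (Fin N)} where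

  FAR-hit : p ∈ c → serve (FAR k G) p (c , ms) ≡ (p ∷ remove p c , p ∷ ms)
  FAR-hit {p = p} {c = c} p∈c rewrite dec-true (p ∈? c) p∈c = refl

  FAR-insert : p ∉ c → length c < k → serve (FAR k G) p (c , ms) ≡ (p ∷ c , p ∷ ms)
  FAR-insert {p = p} {c = c} {k = k} p∉c c<k
    rewrite dec-false (p ∈? c) p∉c | dec-true (length c ℕ.<? k) c<k = refl

  FAR-unmark : p ∉ c → k ≤ length c → All (_∈ ms) c →
               serve (FAR k G) p (c , ms) ≡ (p ∷ evictFarthest G [ p ] c , [ p ])
  FAR-unmark {p = p} {c = c} {k = k} p∉c k≤c c∈ms
    rewrite dec-false (p ∈? c) p∉c | dec-false (length c ℕ.<? k) (ℕ.≤⇒≯ k≤c)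
          | dec-true (all? (_∈? ms) c) c∈ms = refl

  FAR-evict : p ∉ c → k ≤ length c → ¬ All (_∈ ms) c →
              serve (FAR k G) p (c , ms) ≡ (p ∷ evictFarthest G (p ∷ ms) c , p ∷ ms)
  FAR-evict {p = p} {c = c} {k = k} p∉c k≤c c∉ms
    rewrite dec-false (p ∈? c) p∉c | dec-false (length c ℕ.<? k) (ℕ.≤⇒≯ k≤c)
          | dec-false (all? (_∈? ms) c) c∉ms = refl

-- Domination by FWF and the bound per phase

-- A simulation between FWF and `A` on the same requests. Containment makes every FWF hit a hit of
-- `A`; together with `unique` and `bounded` it forces equal caches once FWF's is full.
record Dominated (k : ℕ) (A : Algorithm N) : Set₁ where
  field
    Inv       : List (Fin N) → State A → Set
    empty     : cache A (initial A) ≡ []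
    initially : Inv [] (initial A)
    preserved : ∀ p {c s} → Inv c s → Inv (serve (FWF k) p c) (serve A p s)
    unique    : ∀ {c s} → Inv c s → Unique c
    contained : ∀ {c s} → Inv c s → c ⊆ cache A s
    bounded   : ∀ {c s} → Inv c s → length (cache A s) ≤ k

module _ {A : Algorithm N} (D : Dominated k A) where
  open Dominated D

  faultsFrom-≤ : ∀ I {c s} → Inv c s → faultsFrom A s I ≤ faultsFrom (FWF k) c I
  faultsFrom-≤ []      inv = z≤n
  faultsFrom-≤ (p ∷ I) {c} {s} inv with p ∈? c | p ∈? cache A s | faultsFrom-≤ I (preserved p inv)
  ... | yes p∈c | yes _  | ih = ih
  ... | yes p∈c | no p∉s | ih = contradiction (contained inv p∈c) p∉s
  ... | no _    | yes _  | ih = ℕ.m≤n⇒m≤1+n ih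
  ... | no _    | no _   | ih = s≤s ih

  phase-size : ∀ {c s} → Inv c s → length c ≤ k
  phase-size inv = ℕ.≤-trans (Unique-⊆⇒length≤ (unique inv) (contained inv)) (bounded inv)

  -- FWF's full cache is contained in A's cache, so the two caches agree.
  faults-together : ∀ {c s} → Inv c s → k ≤ length c → p ∉ c → p ∉ cache A s
  faults-together inv k≤c p∉c p∈s =
    p∉c (full-⊆ (unique inv) (contained inv) (ℕ.≤-trans (bounded inv) k≤c) p∈s)

  -- A phase costs FWF at most k faults, length c of which precede I in the current
  -- phase, and A faults at the start of every later phase.
  phase-bound : ∀ I {c s} → Inv c s →
                faultsFrom (FWF k) c I + length c ≤ k * faultsFrom A s I + k
  phase-bound [] inv = ℕ.≤-trans (phase-size inv) (ℕ.m≤n+m k (k * 0))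
  phase-bound (p ∷ I) {c} {s} inv = step (p ∈? c) (length c ℕ.<? k)
    where
    open ℕ.≤-Reasoning
    A′ = faultsFrom A (serve A p s) I

    step : Dec (p ∈ c) → Dec (length c < k) →
           faultsFrom (FWF k) c (p ∷ I) + length c ≤ k * faultsFrom A s (p ∷ I) + k
    step (yes p∈c) _
      rewrite faults-hit (FWF k) I p∈c | faults-hit A I (contained inv p∈c)
            | FWF-hit {k = k} p∈c
      = phase-bound I (subst (λ c → Inv c _) (FWF-hit {k = k} p∈c) (preserved p inv))
    -- The fault merely moves into `length c`. `A` may hit or miss here, and `faults-tail` covers
    -- both.
    step (no p∉c) (yes c<k)
      rewrite faults-miss (FWF k) I p∉c | FWF-insert p∉c c<k = begin
      suc (faultsFrom (FWF k) (p ∷ c) I + length c)  ≡⟨ ℕ.+-suc _ (length c) ⟨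
      faultsFrom (FWF k) (p ∷ c) I + suc (length c)  ≤⟨ phase-bound I inv′ ⟩
      k * A′ + k                                     ≤⟨ ℕ.+-monoˡ-≤ k (ℕ.*-monoʳ-≤ k (faults-tail A I)) ⟩
      k * faultsFrom A s (p ∷ I) + k                 ∎
      where inv′ = subst (λ c → Inv c _) (FWF-insert p∉c c<k) (preserved p inv)
    -- The flush lets `length c` fall from `k` to 1, and the simultaneous fault of `A` pays for this
    -- with `k`.
    step (no p∉c) (no c≮k)
      rewrite faults-miss (FWF k) I p∉c | FWF-flush p∉c (ℕ.≮⇒≥ c≮k)
            | faults-miss A I (faults-together inv (ℕ.≮⇒≥ c≮k) p∉c) = begin
      suc (F + length c)  ≤⟨ s≤s (ℕ.+-monoʳ-≤ F (phase-size inv)) ⟩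
      suc (F + k)         ≡⟨ cong (_+ k) (ℕ.+-comm 1 F) ⟩
      (F + 1) + k         ≤⟨ ℕ.+-monoˡ-≤ k (phase-bound I inv′) ⟩
      (k * A′ + k) + k    ≡⟨ cong (_+ k) (ℕ.+-comm (k * A′) k) ⟩
      (k + k * A′) + k    ≡⟨ cong (_+ k) (ℕ.*-suc k A′) ⟨
      k * suc A′ + k      ∎
      where
      F    = faultsFrom (FWF k) [ p ] I
      inv′ = subst (λ c → Inv c _) (FWF-flush p∉c (ℕ.≮⇒≥ c≮k)) (preserved p inv)

faultsFrom-≤-length : ∀ (A : Algorithm N) {s} I → faultsFrom A s I ≤ length I
faultsFrom-≤-length A []      = z≤n
faultsFrom-≤-length A {s} (p ∷ I) with does (p ∈? cache A s)
... | true  = ℕ.m≤n⇒m≤1+n (faultsFrom-≤-length A I)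
... | false = s≤s (faultsFrom-≤-length A I)

-- LRU is dominated by FWF

∈-∷⇒∈-∷-remove : ∀ {q} → q ∈ p ∷ xs → q ∈ p ∷ remove p xs
∈-∷⇒∈-∷-remove (here q≡p) = here q≡p
∈-∷⇒∈-∷-remove {p = p} {q = q} (there q∈xs) with q Fin.≟ p
... | yes q≡p = here q≡p
... | no  q≢p = there (∈-remove⁺ q∈xs q≢p)

-- FWF's cache consists of the pages requested since the last flush, and these
-- are the most recent entries of LRU's cache.
record LRUInv (k : ℕ) (c s : List (Fin N)) : Set where
  field
    {recent older} : List (Fin N)
    split     : s ≡ recent ++ older
    unique    : Unique c
    contained : c ⊆ recent
    recent≤   : length recent ≤ length c
    bounded   : length s ≤ k

  c⊆s : c ⊆ s
  c⊆s q∈c = subst (_ ∈_) (sym split) (∈-++⁺ˡ (contained q∈c))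

nonempty : ∀ {A : Set} {xs : List A} → 1 ≤ length xs → ∃[ x ] x ∈ xs
nonempty {xs = x ∷ _} _ = x , here refl

remove-++ : ∀ (p : Fin N) xs {ys} → remove p (xs ++ ys) ≡ remove p xs ++ remove p ys
remove-++ p xs = List.filter-++ (λ q → ¬? (q Fin.≟ p)) xs _

module _ {k : ℕ} (1≤k : 1 ≤ k) where

  dropLast-bounded : ∀ {c s : List (Fin N)} → LRUInv k c s → suc (length (dropLast s)) ≤ k
  dropLast-bounded {s = s} inv rewrite length-dropLast s = ℕ.≤-trans
    (s≤s (ℕ.∸-monoˡ-≤ 1 (LRUInv.bounded inv))) (ℕ.≤-reflexive (ℕ.m+[n∸m]≡n 1≤k))

  LRU-preserved : ∀ (p : Fin N) {c s} → LRUInv k c s →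
                  LRUInv k (serve (FWF k) p c) (serve (LRU k) p s)
  LRU-preserved p {c} {s} inv = step (p ∈? c) (p ∈? s) (length c ℕ.<? k) (length s ℕ.<? k)
    where
    open LRUInv inv

    -- While FWF has room, `recent` is too short to fill LRU's cache. So `older` is nonempty and the
    -- evicted page comes from it.
    evict : ∀ recent older → s ≡ recent ++ older → length recent < k → k ≤ length s →
            ∃[ older′ ] dropLast s ≡ recent ++ older′
    evict recent []       refl r<k k≤s = contradiction
      (subst (λ xs → k ≤ length xs) (List.++-identityʳ recent) k≤s) (ℕ.<⇒≱ r<k)
    evict recent (y ∷ ys) refl _   _   = _ , dropLast-++ recent

    step : Dec (p ∈ c) → Dec (p ∈ s) → Dec (length c < k) → Dec (length s < k) →
           LRUInv k (serve (FWF k) p c) (serve (LRU k) p s)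
    step (yes p∈c) (no p∉s) _ _ = contradiction (c⊆s p∈c) p∉s
    step (yes p∈c) (yes p∈s) _ _
      rewrite FWF-hit {k = k} p∈c | LRU-hit {k = k} p∈s = record
      { split     = cong (p ∷_) (trans (cong (remove p) split) (remove-++ p recent))
      ; unique    = unique
      ; contained = λ q∈c → ∈-∷⇒∈-∷-remove (there (contained q∈c))
      ; recent≤   = ℕ.≤-trans (remove-shorter (contained p∈c)) recent≤
      ; bounded   = ℕ.≤-trans (remove-shorter p∈s) bounded
      }
    step (no p∉c) (yes p∈s) (yes c<k) _
      rewrite FWF-insert p∉c c<k | LRU-hit {k = k} p∈s = record
      { split     = cong (p ∷_) (trans (cong (remove p) split) (remove-++ p recent))
      ; unique    = p∉c ∷ᵘ unique
      ; contained = ∈-∷⇒∈-∷-remove ∘ ∷⁺ʳ p contained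
      ; recent≤   = s≤s (ℕ.≤-trans (remove-no-longer p recent) recent≤)
      ; bounded   = ℕ.≤-trans (remove-shorter p∈s) bounded
      }
    -- A full FWF cache has the same pages as LRU's, so LRU cannot hit where FWF flushes.
    step (no p∉c) (yes p∈s) (no c≮k) _ =
      contradiction (full-⊆ unique c⊆s (ℕ.≤-trans bounded (ℕ.≮⇒≥ c≮k)) p∈s) p∉c
    step (no p∉c) (no p∉s) (yes c<k) (yes s<k)
      rewrite FWF-insert p∉c c<k | LRU-insert p∉s s<k = record
      { split     = cong (p ∷_) split
      ; unique    = p∉c ∷ᵘ unique
      ; contained = ∷⁺ʳ p contained
      ; recent≤   = s≤s recent≤
      ; bounded   = s<k
      }
    step (no p∉c) (no p∉s) (no c≮k) (yes s<k) =
      contradiction (ℕ.≤-<-trans (Unique-⊆⇒length≤ unique c⊆s) s<k) c≮k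
    step (no p∉c) (no p∉s) (yes c<k) (no s≮k)
      rewrite FWF-insert p∉c c<k | LRU-evict p∉s (ℕ.≮⇒≥ s≮k) = record
      { split     = cong (p ∷_) (proj₂ (evict recent older split (ℕ.≤-<-trans recent≤ c<k) (ℕ.≮⇒≥ s≮k)))
      ; unique    = p∉c ∷ᵘ unique
      ; contained = ∷⁺ʳ p contained
      ; recent≤   = s≤s recent≤
      ; bounded   = dropLast-bounded inv
      }
    -- A new phase begins: all surviving pages become `older`.
    step (no p∉c) (no p∉s) (no c≮k) (no s≮k)
      rewrite FWF-flush p∉c (ℕ.≮⇒≥ c≮k) | LRU-evict p∉s (ℕ.≮⇒≥ s≮k) = record
      { recent    = [ p ]
      ; split     = refl
      ; unique    = [] ∷ []
      ; contained = id
      ; recent≤   = ℕ.≤-refl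
      ; bounded   = dropLast-bounded inv
      }

  LRU-dominated : Dominated {N} k (LRU k)
  LRU-dominated = record
    { Inv       = LRUInv k
    ; empty     = refl
    ; initially = record
      { recent = [] ; split = refl ; unique = [] ; contained = id ; recent≤ = z≤n ; bounded = z≤n }
    ; preserved = LRU-preserved
    ; unique    = LRUInv.unique
    ; contained = LRUInv.c⊆s
    ; bounded   = LRUInv.bounded
    }

-- FAR is dominated by FWF

-- FAR unmarks all pages exactly when FWF flushes its cache, so the marked pages
-- are those in FWF's cache.
record FARInv (k : ℕ) (c pages marked : List (Fin N)) : Set where
  field
    unique       : Unique c
    unique-pages : Unique pages
    contained    : c ⊆ pages
    bounded      : length pages ≤ k
    c⊆marked     : c ⊆ marked
    marked⊆c     : marked ⊆ c

lastArgmax-∈ : ∀ {A : Set} (f : A → ℕ) x xs → lastArgmax f x xs ∈ x ∷ xs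
lastArgmax-∈ f x []       = here refl
lastArgmax-∈ f x (y ∷ ys) with does (f x ℕ.≤? f y)
... | true  = there (lastArgmax-∈ f y ys)
... | false with lastArgmax-∈ f x ys
...   | here eq   = here eq
...   | there e∈ = there (there e∈)

-- All that domination uses of FAR's choice: the evicted page is cached and unmarked. The witness
-- `q` excludes the branch that evicts nothing.
evictFarthest-remove : ∀ (G : Graph N) {ms} → q ∈ c → q ∉ ms →
                       ∃[ e ] e ∈ c × e ∉ ms × evictFarthest G ms c ≡ remove e c
evictFarthest-remove {q = q} {c = c} G {ms} q∈c q∉ms
  with filter (λ q → ¬? (q ∈? ms)) c in eq
... | []     = contradiction (subst (q ∈_) eq (∈-filter⁺ _ q∈c q∉ms)) λ ()
... | x ∷ xs = _ , proj₁ e∈ , proj₂ e∈ , refl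
  where
  e∈ = ∈-filter⁻ _ {xs = c} (subst (_ ∈_) (sym eq) (lastArgmax-∈ (distanceTo G ms) x xs))

module _ {k : ℕ} (1≤k : 1 ≤ k) (G : Graph N) where

  FAR-preserved : ∀ p {c s} → FARInv k c (proj₁ s) (proj₂ s) →
                  let s′ = serve (FAR k G) p s in
                  FARInv k (serve (FWF k) p c) (proj₁ s′) (proj₂ s′)
  FAR-preserved p {c} {a , ms} inv =
    step (p ∈? c) (p ∈? a) (length c ℕ.<? k) (length a ℕ.<? k) (all? (_∈? ms) a)
    where
    open FARInv inv

    unique-moved : ∀ {xs} → Unique xs → Unique (p ∷ remove p xs)
    unique-moved {xs} u = ∉-remove xs ∷ᵘ Unique.filter⁺ _ u

    unique-evicted : ∀ {e} → p ∉ a → Unique (p ∷ remove e a)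
    unique-evicted p∉a = (p∉a ∘ proj₁ ∘ ∈-remove⁻ a) ∷ᵘ Unique.filter⁺ _ unique-pages

    step : Dec (p ∈ c) → Dec (p ∈ a) → Dec (length c < k) → Dec (length a < k) → Dec (All (_∈ ms) a) →
           let s′ = serve (FAR k G) p (a , ms) in
           FARInv k (serve (FWF k) p c) (proj₁ s′) (proj₂ s′)
    step (yes p∈c) (no p∉a) _ _ _ = contradiction (contained p∈c) p∉a
    step (yes p∈c) (yes p∈a) _ _ _
      rewrite FWF-hit {k = k} p∈c | FAR-hit G {ms} {k = k} p∈a = record
      { unique       = unique
      ; unique-pages = unique-moved unique-pages
      ; contained    = λ q∈c → ∈-∷⇒∈-∷-remove (there (contained q∈c))
      ; bounded      = ℕ.≤-trans (remove-shorter p∈a) bounded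
      ; c⊆marked     = there ∘ c⊆marked
      ; marked⊆c     = λ { (here refl) → p∈c ; (there q∈ms) → marked⊆c q∈ms }
      }
    step (no p∉c) (yes p∈a) (yes c<k) _ _
      rewrite FWF-insert p∉c c<k | FAR-hit G {ms} {k = k} p∈a = record
      { unique       = p∉c ∷ᵘ unique
      ; unique-pages = unique-moved unique-pages
      ; contained    = ∈-∷⇒∈-∷-remove ∘ ∷⁺ʳ p contained
      ; bounded      = ℕ.≤-trans (remove-shorter p∈a) bounded
      ; c⊆marked     = ∷⁺ʳ p c⊆marked
      ; marked⊆c     = ∷⁺ʳ p marked⊆c
      }
    step (no p∉c) (yes p∈a) (no c≮k) _ _ =
      contradiction (full-⊆ unique contained (ℕ.≤-trans bounded (ℕ.≮⇒≥ c≮k)) p∈a) p∉c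
    step (no p∉c) (no p∉a) (yes c<k) (yes a<k) _
      rewrite FWF-insert p∉c c<k | FAR-insert G {ms} p∉a a<k = record
      { unique       = p∉c ∷ᵘ unique
      ; unique-pages = p∉a ∷ᵘ unique-pages
      ; contained    = ∷⁺ʳ p contained
      ; bounded      = a<k
      ; c⊆marked     = ∷⁺ʳ p c⊆marked
      ; marked⊆c     = ∷⁺ʳ p marked⊆c
      }
    step (no p∉c) (no p∉a) (no c≮k) (yes a<k) _ =
      contradiction (ℕ.≤-<-trans (Unique-⊆⇒length≤ unique contained) a<k) c≮k
    -- No unmarking without a flush: a full cache of marked pages would give at least `k` distinct
    -- pages in `c`, which has room.
    step (no p∉c) (no p∉a) (yes c<k) (no a≮k) (yes a∈ms) =
      contradiction (ℕ.≤-<-trans (Unique-⊆⇒length≤ unique-pages (marked⊆c ∘ All.lookup a∈ms)) c<k) a≮k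
    -- No flush without unmarking: a full `c` has the same pages as `a`, and all of them are marked.
    step (no p∉c) (no p∉a) (no c≮k) (no a≮k) (no a∉ms) = contradiction
      (All.tabulate (c⊆marked ∘ full-⊆ unique contained (ℕ.≤-trans bounded (ℕ.≮⇒≥ c≮k)))) a∉ms
    step (no p∉c) (no p∉a) (no c≮k) (no a≮k) (yes a∈ms)
      rewrite FWF-flush p∉c (ℕ.≮⇒≥ c≮k) | FAR-unmark G {ms} p∉a (ℕ.≮⇒≥ a≮k) a∈ms
      -- Only `p` is marked now and `p` is not cached, so any cached page shows that an eviction
      -- takes place; `1 ≤ k` provides one.
      with nonempty (ℕ.≤-trans 1≤k (ℕ.≮⇒≥ a≮k))
    ... | q , q∈a with evictFarthest-remove G {[ p ]} q∈a (λ { (here refl) → p∉a q∈a })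
    ... | e , e∈a , _ , eq rewrite eq = record
      { unique       = [] ∷ []
      ; unique-pages = unique-evicted p∉a
      ; contained    = λ { (here q≡p) → here q≡p }
      ; bounded      = ℕ.≤-trans (remove-shorter e∈a) bounded
      ; c⊆marked     = id
      ; marked⊆c     = id
      }
    step (no p∉c) (no p∉a) (yes c<k) (no a≮k) (no a∉ms)
      rewrite FWF-insert p∉c c<k | FAR-evict G {ms} p∉a (ℕ.≮⇒≥ a≮k) a∉ms
      with find (All.¬All⇒Any¬ (_∈? ms) a a∉ms)
    ... | q , q∈a , q∉ms
      with evictFarthest-remove G {p ∷ ms} q∈a (λ { (here refl) → p∉a q∈a ; (there q∈ms) → q∉ms q∈ms })
    ... | e , e∈a , e∉ms , eq rewrite eq = record
      { unique       = p∉c ∷ᵘ unique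
      ; unique-pages = unique-evicted p∉a
      -- The evicted `e` is unmarked, whereas all pages of `c` are marked.
      ; contained    = ∷⁺ʳ p λ q∈c → ∈-remove⁺ (contained q∈c) λ { refl → e∉ms (there (c⊆marked q∈c)) }
      ; bounded      = ℕ.≤-trans (remove-shorter e∈a) bounded
      ; c⊆marked     = ∷⁺ʳ p c⊆marked
      ; marked⊆c     = ∷⁺ʳ p marked⊆c
      }

  FAR-dominated : Dominated k (FAR k G)
  FAR-dominated = record
    { Inv       = λ c s → FARInv k c (proj₁ s) (proj₂ s)
    ; empty     = refl
    ; initially = record
      { unique = [] ; unique-pages = [] ; contained = id ; bounded = z≤n ; c⊆marked = id ; marked⊆c = id }
    ; preserved = FAR-preserved
    ; unique    = FARInv.unique
    ; contained = FARInv.contained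
    ; bounded   = FARInv.bounded
    }

-- The zigzag along a path

-- With zs of length k - 1, the requests run back and forth along the path y, zs, z.
zigzag : ℕ → Fin N → List (Fin N) → Fin N → List (Fin N)
zigzag zero    y zs z = []
zigzag (suc m) y zs z = y ∷ zs ++ zigzag m z (reverse zs) y

length-zigzag : ∀ m (y : Fin N) zs z → length (zigzag m y zs z) ≡ m * suc (length zs)
length-zigzag zero    y zs z = refl
length-zigzag (suc m) y zs z
  rewrite List.length-++ zs {zigzag m z (reverse zs) y} | length-zigzag m z (reverse zs) y
        | List.length-reverse zs = refl

reverse-ends : ∀ {A : Set} (y : A) zs z → reverse (y ∷ zs ∷ʳ z) ≡ z ∷ reverse zs ∷ʳ y
reverse-ends y zs z = trans (List.unfold-reverse y (zs ∷ʳ z)) (cong (_∷ʳ y) (List.reverse-++ zs [ z ]))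

module _ {A : Set} {R : Rel A 0ℓ} where

  Linked-ʳ++ : Symmetric R → ∀ {x xs ys} → Linked R (x ∷ xs) → Linked R (x ∷ ys) → Linked R (xs ʳ++ x ∷ ys)
  Linked-ʳ++ R-sym [-]      Rys = Rys
  Linked-ʳ++ R-sym (r ∷ rs) Rys = Linked-ʳ++ R-sym rs (R-sym r ∷ Rys)

  -- A turn stops just before `z`, which opens the next turn. The step into `z` is therefore taken
  -- from the path, and everything later from the next turn.
  Linked-bridge : ∀ y zs {z xs} → Linked R (y ∷ zs ∷ʳ z) → Linked R (z ∷ xs) → Linked R (y ∷ zs ++ z ∷ xs)
  Linked-bridge y []       (r ∷ _)  Rxs = r ∷ Rxs
  Linked-bridge y (x ∷ zs) (r ∷ rs) Rxs = r ∷ Linked-bridge x zs rs Rxs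

  Linked-init : ∀ y zs {z} → Linked R (y ∷ zs ∷ʳ z) → Linked R (y ∷ zs)
  Linked-init y []       (r ∷ _)  = [-]
  Linked-init y (x ∷ zs) (r ∷ rs) = r ∷ Linked-init x zs rs

Linked-zigzag : ∀ {R : Rel (Fin N) 0ℓ} → Symmetric R → ∀ m {y zs z} →
                Linked R (y ∷ zs ∷ʳ z) → Linked R (zigzag m y zs z)
Linked-zigzag R-sym zero Rs = []
-- The last turn has no successor that would request `z`, so the path is cut before its end.
Linked-zigzag R-sym (suc zero) {y} {zs} Rs =
  subst (Linked _ ∘ (y ∷_)) (sym (List.++-identityʳ zs)) (Linked-init y zs Rs)
Linked-zigzag {R = R} R-sym (suc (suc m)) {y} {zs} {z} Rs = Linked-bridge y zs Rs
  (Linked-zigzag R-sym (suc m) (subst (Linked R) (reverse-ends y zs z) (Linked-ʳ++ R-sym Rs [-])))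

-- When a turn starts at y, each cache is zs ∷ʳ z, ordered by recency.
record Course (k : ℕ) (y : Fin N) (zs : List (Fin N)) (z : Fin N) : Set where
  field
    distinct : Unique (y ∷ zs ∷ʳ z)
    size     : suc (length zs) ≡ k

  y∉ : y ∉ zs ∷ʳ z
  y∉ = Unique.Unique[x∷xs]⇒x∉xs distinct

  length-∷ʳ : length (zs ∷ʳ z) ≡ k
  length-∷ʳ = trans (List.length-++ zs) (trans (ℕ.+-comm _ 1) size)

  private
    distinct-rotated : Unique (z ∷ y ∷ zs)
    distinct-rotated = Unique-resp-↭ (↭-sym (∷↭∷ʳ z (y ∷ zs))) distinct

  distinct-front : Unique (y ∷ zs)
  distinct-front = AllPairs.tail distinct-rotated

  z∉zs : z ∉ zs
  z∉zs = Unique.Unique[x∷xs]⇒x∉xs distinct-rotated ∘ there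

Course-flip : Course k y zs z → Course k z (reverse zs) y
Course-flip {y = y} {zs = zs} {z = z} course = record
  { distinct = subst Unique (reverse-ends y zs z) (Unique-resp-↭ (↭-sym (↭-reverse _)) distinct)
  ; size     = trans (cong suc (List.length-reverse zs)) size
  } where open Course course

-- FWF on the zigzag

module _ {k : ℕ} (A : Algorithm N) (state : List (Fin N) → State A)
         (cache-state : ∀ c → cache A (state c) ≡ c)
         (insert : ∀ {p c} → p ∉ c → length c < k → serve A p (state c) ≡ state (p ∷ c)) where

  -- New pages entering a cache with room all fault. The parameter `state` lets one induction serve
  -- FWF and also the algorithms that track marks.
  faults-fill : ∀ acc qs I → Unique (acc ++ qs) → length (acc ++ qs) ≤ k →
                faultsFrom A (state acc) (qs ++ I) ≡ length qs + faultsFrom A (state (qs ʳ++ acc)) I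
  faults-fill acc [] I _ _ = refl
  faults-fill acc (q ∷ qs) I distinct fits = begin
    faultsFrom A (state acc) (q ∷ qs ++ I)
      ≡⟨ faults-miss A (qs ++ I) (q∉acc ∘ subst (q ∈_) (cache-state acc)) ⟩
    suc (faultsFrom A (serve A q (state acc)) (qs ++ I))
      ≡⟨ cong (λ s → suc (faultsFrom A s (qs ++ I))) (insert q∉acc acc<k) ⟩
    suc (faultsFrom A (state (q ∷ acc)) (qs ++ I))
      ≡⟨ cong suc (faults-fill (q ∷ acc) qs I distinct′ fits′) ⟩
    suc (length qs + faultsFrom A (state (qs ʳ++ q ∷ acc)) I) ∎
    where
    open ≡-Reasoning
    distinct′ = Unique-resp-↭ (shift q acc qs) distinct
    fits′     = subst (_≤ k) (↭-length (shift q acc qs)) fits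
    q∉acc     = Unique.Unique[x∷xs]⇒x∉xs distinct′ ∘ ∈-++⁺ˡ
    acc<k     = ℕ.≤-trans (s≤s (List.length-++-≤ˡ acc)) fits′

FWF-fill : ∀ acc qs I → Unique (acc ++ qs) → length (acc ++ qs) ≤ k →
           faultsFrom (FWF {N} k) acc (qs ++ I) ≡ length qs + faultsFrom (FWF k) (qs ʳ++ acc) I
FWF-fill {k = k} = faults-fill (FWF k) id (λ _ → refl) FWF-insert

-- The request to `y` flushes, and the `k - 1` pages of `zs` refill the emptied cache, so all `k`
-- requests fault. The resulting cache is the one from which the reversed turn starts.
FWF-zigzag-from : ∀ m → Course k y zs z → faultsFrom (FWF k) (zs ∷ʳ z) (zigzag m y zs z) ≡ m * k
FWF-zigzag-from zero course = refl
FWF-zigzag-from {k = k} {y = y} {zs = zs} {z = z} (suc m) course = begin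
  faultsFrom (FWF k) (zs ∷ʳ z) (y ∷ zs ++ rest)
    ≡⟨ faults-miss (FWF k) (zs ++ rest) y∉ ⟩
  suc (faultsFrom (FWF k) (serve (FWF k) y (zs ∷ʳ z)) (zs ++ rest))
    ≡⟨ cong (λ s → suc (faultsFrom (FWF k) s (zs ++ rest)))
            (FWF-flush y∉ (ℕ.≤-reflexive (sym length-∷ʳ))) ⟩
  suc (faultsFrom (FWF k) [ y ] (zs ++ rest))
    ≡⟨ cong suc (FWF-fill [ y ] zs rest distinct-front (ℕ.≤-reflexive size)) ⟩
  suc (length zs) + faultsFrom (FWF k) (zs ʳ++ [ y ]) rest
    ≡⟨ cong₂ _+_ size (cong (λ s → faultsFrom (FWF k) s rest) (List.ʳ++-defn zs)) ⟩
  k + faultsFrom (FWF k) (reverse zs ∷ʳ y) rest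
    ≡⟨ cong (λ l → k + l) (FWF-zigzag-from m (Course-flip course)) ⟩
  k + m * k ∎
  where
  open ≡-Reasoning
  open Course course
  rest = zigzag m z (reverse zs) y

FWF-zigzag : ∀ m → Course k y zs z → faults (FWF k) (zigzag (suc m) y zs z) ≡ suc m * k
FWF-zigzag {k = k} {y = y} {zs = zs} {z = z} m course = begin
  faults (FWF k) (y ∷ zs ++ rest)
    ≡⟨ FWF-fill [] (y ∷ zs) rest distinct-front (ℕ.≤-reflexive size) ⟩
  suc (length zs) + faultsFrom (FWF k) (zs ʳ++ [ y ]) rest
    ≡⟨ cong₂ _+_ size (cong (λ s → faultsFrom (FWF k) s rest) (List.ʳ++-defn zs)) ⟩
  k + faultsFrom (FWF k) (reverse zs ∷ʳ y) rest
    ≡⟨ cong (λ l → k + l) (FWF-zigzag-from m (Course-flip course)) ⟩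
  k + m * k ∎
  where
  open ≡-Reasoning
  open Course course
  rest = zigzag m z (reverse zs) y

-- LRU and FAR on the zigzag

-- LRU has no marks: its state function ignores them.
record MovesToFront (k : ℕ) (A : Algorithm N) : Set₁ where
  field
    state         : (pages marked : List (Fin N)) → State A
    initial-state : initial A ≡ state [] []
    cache-state   : ∀ c ms → cache A (state c ms) ≡ c
    hit           : ∀ {p c ms} → p ∈ c → serve A p (state c ms) ≡ state (p ∷ remove p c) (p ∷ ms)
    insert        : ∀ {p c ms} → p ∉ c → length c < k → serve A p (state c ms) ≡ state (p ∷ c) (p ∷ ms)

LRU-movesToFront : MovesToFront {N} k (LRU k)
LRU-movesToFront {k = k} = record
  { state         = λ c ms → c
  ; initial-state = refl
  ; cache-state   = λ c ms → refl
  ; hit           = LRU-hit {k = k}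
  ; insert        = LRU-insert
  }

FAR-movesToFront : (G : Graph N) → MovesToFront k (FAR k G)
FAR-movesToFront {k = k} G = record
  { state         = _,_
  ; initial-state = refl
  ; cache-state   = λ c ms → refl
  ; hit           = FAR-hit G {k = k}
  ; insert        = FAR-insert G
  }

remove-middle : ∀ (acc : List (Fin N)) q qs → q ∉ acc ++ qs → remove q (acc ++ q ∷ qs) ≡ acc ++ qs
remove-middle acc q qs q∉ = begin
  remove q (acc ++ q ∷ qs)            ≡⟨ remove-++ q acc ⟩
  remove q acc ++ remove q (q ∷ qs)   ≡⟨ cong (remove q acc ++_) (remove-head q qs) ⟩
  remove q acc ++ remove q qs         ≡⟨ cong₂ _++_ (remove-∉ (q∉ ∘ ∈-++⁺ˡ)) (remove-∉ (q∉ ∘ ∈-++⁺ʳ acc)) ⟩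
  acc ++ qs                           ∎
  where open ≡-Reasoning

module _ {A : Algorithm N} (M : MovesToFront k A) where
  open MovesToFront M

  -- All pages ahead are cached, so nothing faults. `acc` holds the pages already passed: they are
  -- at once the front of the cache and the marked pages. At the end the whole cache is marked and
  -- its order is reversed.
  faults-sweep : ∀ acc qs I → Unique (acc ++ qs) →
                 faultsFrom A (state (acc ++ qs) acc) (qs ++ I) ≡
                 faultsFrom A (state (qs ʳ++ acc) (qs ʳ++ acc)) I
  faults-sweep acc [] I _ = cong (λ c → faultsFrom A (state c acc) I) (List.++-identityʳ acc)
  faults-sweep acc (q ∷ qs) I distinct = begin
    faultsFrom A (state (acc ++ q ∷ qs) acc) (q ∷ qs ++ I)
      ≡⟨ faults-hit A (qs ++ I) (subst (q ∈_) (sym (cache-state _ _)) (∈-++⁺ʳ acc (here refl))) ⟩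
    faultsFrom A (serve A q (state (acc ++ q ∷ qs) acc)) (qs ++ I)
      ≡⟨ cong (λ s → faultsFrom A s (qs ++ I)) (hit (∈-++⁺ʳ acc (here refl))) ⟩
    faultsFrom A (state (q ∷ remove q (acc ++ q ∷ qs)) (q ∷ acc)) (qs ++ I)
      ≡⟨ cong (λ c → faultsFrom A (state (q ∷ c) (q ∷ acc)) (qs ++ I))
              (remove-middle acc q qs (Unique.Unique[x∷xs]⇒x∉xs distinct′)) ⟩
    faultsFrom A (state (q ∷ acc ++ qs) (q ∷ acc)) (qs ++ I)
      ≡⟨ faults-sweep (q ∷ acc) qs I distinct′ ⟩
    faultsFrom A (state (qs ʳ++ q ∷ acc) (qs ʳ++ q ∷ acc)) I ∎
    where
    open ≡-Reasoning
    distinct′ = Unique-resp-↭ (shift q acc qs) distinct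

  module _ (P : Fin N → List (Fin N) → Fin N → Set)
           (flip : ∀ {y zs z} → P y zs z → P z (reverse zs) y)
           (evict : ∀ {y zs z} → Course k y zs z → P y zs z →
                    serve A y (state (zs ∷ʳ z) (zs ∷ʳ z)) ≡ state (y ∷ zs) [ y ]) where

    -- Only the opening request of a turn faults; it evicts `z`, which is not requested before the
    -- next turn. `P` is the geometric condition behind this eviction, trivial for LRU and
    -- `Farthest` for FAR, and `flip` provides it for the way back.
    faults-zigzag-from : ∀ m {y zs z} → Course k y zs z → P y zs z →
                         faultsFrom A (state (zs ∷ʳ z) (zs ∷ʳ z)) (zigzag m y zs z) ≡ m
    faults-zigzag-from zero _ _ = refl
    faults-zigzag-from (suc m) {y} {zs} {z} course Pyz = begin
      faultsFrom A (state (zs ∷ʳ z) (zs ∷ʳ z)) (y ∷ zs ++ rest)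
        ≡⟨ faults-miss A (zs ++ rest) (y∉ ∘ subst (y ∈_) (cache-state _ _)) ⟩
      suc (faultsFrom A (serve A y (state (zs ∷ʳ z) (zs ∷ʳ z))) (zs ++ rest))
        ≡⟨ cong (λ s → suc (faultsFrom A s (zs ++ rest))) (evict course Pyz) ⟩
      suc (faultsFrom A (state (y ∷ zs) [ y ]) (zs ++ rest))
        ≡⟨ cong suc (faults-sweep [ y ] zs rest distinct-front) ⟩
      suc (faultsFrom A (state (zs ʳ++ [ y ]) (zs ʳ++ [ y ])) rest)
        ≡⟨ cong (λ c → suc (faultsFrom A (state c c) rest)) (List.ʳ++-defn zs) ⟩
      suc (faultsFrom A (state (reverse zs ∷ʳ y) (reverse zs ∷ʳ y)) rest)
        ≡⟨ cong suc (faults-zigzag-from m (Course-flip course) (flip Pyz)) ⟩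
      suc m ∎
      where
      open ≡-Reasoning
      open Course course
      rest = zigzag m z (reverse zs) y

    -- The first turn fills the empty cache with `k` faults; each of the `m` later turns adds one.
    faults-zigzag : ∀ m {y zs z} → Course k y zs z → P y zs z →
                    faults A (zigzag (suc m) y zs z) ≡ k + m
    faults-zigzag m {y} {zs} {z} course Pyz = begin
      faultsFrom A (initial A) (y ∷ zs ++ rest)
        ≡⟨ cong (λ s → faultsFrom A s (y ∷ zs ++ rest)) initial-state ⟩
      faultsFrom A (state [] []) (y ∷ zs ++ rest)
        ≡⟨ faults-fill A (λ c → state c c) (λ c → cache-state c c) insert
             [] (y ∷ zs) rest distinct-front (ℕ.≤-reflexive size) ⟩
      suc (length zs) + faultsFrom A (state (zs ʳ++ [ y ]) (zs ʳ++ [ y ])) rest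
        ≡⟨ cong₂ _+_ size (cong (λ c → faultsFrom A (state c c) rest) (List.ʳ++-defn zs)) ⟩
      k + faultsFrom A (state (reverse zs ∷ʳ y) (reverse zs ∷ʳ y)) rest
        ≡⟨ cong (λ l → k + l) (faults-zigzag-from m (Course-flip course) (flip Pyz)) ⟩
      k + m ∎
      where
      open ≡-Reasoning
      open Course course
      rest = zigzag m z (reverse zs) y

-- The eviction at a turn

LRU-turn : Course k y zs z → serve (LRU k) y (zs ∷ʳ z) ≡ y ∷ zs
LRU-turn {y = y} {zs = zs} {z = z} course = trans
  (LRU-evict y∉ (ℕ.≤-reflexive (sym length-∷ʳ))) (cong (y ∷_) (dropLast-∷ʳ zs z))
  where open Course course

-- Weak inequalities suffice because ties go to the later entry.
lastArgmax-∷ʳ : ∀ {A : Set} (f : A → ℕ) x ys {z} → f x ≤ f z → All (λ y → f y ≤ f z) ys →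
                lastArgmax f x (ys ∷ʳ z) ≡ z
lastArgmax-∷ʳ f x [] {z} fx≤fz [] rewrite dec-true (f x ℕ.≤? f z) fx≤fz = refl
lastArgmax-∷ʳ f x (y ∷ ys) fx≤fz (fy≤fz ∷ f≤fz) with does (f x ℕ.≤? f y)
... | true  = lastArgmax-∷ʳ f y ys fy≤fz f≤fz
... | false = lastArgmax-∷ʳ f x ys fx≤fz f≤fz

remove-last : ∀ (zs : List (Fin N)) {z} → z ∉ zs → remove z (zs ∷ʳ z) ≡ zs
remove-last zs {z} z∉zs = trans
  (remove-middle zs z [] (z∉zs ∘ subst (z ∈_) (List.++-identityʳ zs))) (List.++-identityʳ zs)

evictFarthest-last : ∀ (G : Graph N) {ms} zs {z} → All (_∉ ms) (zs ∷ʳ z) → z ∉ zs →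
                     All (λ q → distanceTo G ms q ≤ distanceTo G ms z) zs →
                     evictFarthest G ms (zs ∷ʳ z) ≡ zs
evictFarthest-last G {ms} zs {z} unmarked z∉zs far
  -- No cached page is marked, so the filter changes nothing; matching the equation with `refl` lets
  -- `evictFarthest` reduce on the cache itself.
  with filter (λ q → ¬? (q ∈? ms)) (zs ∷ʳ z) | List.filter-all (λ q → ¬? (q ∈? ms)) unmarked
evictFarthest-last G {ms} []       {z} _ z∉zs _ | _ | refl = remove-last [] z∉zs
evictFarthest-last G {ms} (x ∷ zs) {z} _ z∉zs (fx≤fz ∷ far) | _ | refl
  rewrite lastArgmax-∷ʳ (distanceTo G ms) x zs fx≤fz far = remove-last (x ∷ zs) z∉zs

-- One condition per direction: `from-y` when `y` is requested and `z` evicted, `from-z` for the way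
-- back.
record Farthest (G : Graph N) (y : Fin N) (zs : List (Fin N)) (z : Fin N) : Set where
  field
    from-y : All (λ q → distance G q y ≤ distance G z y) zs
    from-z : All (λ q → distance G q z ≤ distance G y z) zs

Farthest-flip : ∀ {G : Graph N} → Farthest G y zs z → Farthest G z (reverse zs) y
Farthest-flip far = record
  { from-y = All-resp-↭ (↭-sym (↭-reverse _)) from-z
  ; from-z = All-resp-↭ (↭-sym (↭-reverse _)) from-y
  } where open Farthest far

FAR-turn : ∀ (G : Graph N) → Course k y zs z → Farthest G y zs z →
           serve (FAR k G) y (zs ∷ʳ z , zs ∷ʳ z) ≡ (y ∷ zs , [ y ])
FAR-turn {N = N} {y = y} {zs = zs} {z = z} G course far = trans
  -- At a turn the marked pages are exactly the cached ones, so FAR unmarks and only `y` is marked.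
  (FAR-unmark G y∉ (ℕ.≤-reflexive (sym length-∷ʳ)) (All.tabulate id))
  (cong (λ c → y ∷ c , [ y ]) (evictFarthest-last G zs
    (All.tabulate λ { q∈ (here refl) → y∉ q∈ }) z∉zs
    -- For the single marked page `y`, `distanceTo` is the distance to `y` capped at `N`, the start
    -- value of its fold.
    (All.map (ℕ.⊓-monoˡ-≤ N) (Farthest.from-y far))))
  where open Course course

-- Distances in path graphs

length-takeWhile-applyUpTo : ∀ {A : Set} {P : Pred A 0ℓ} (P? : Decidable P) f {m n} → m ≤ n →
  (∀ {i} → i < m → P (f i)) → ¬ P (f m) → length (takeWhile P? (applyUpTo f n)) ≡ m
length-takeWhile-applyUpTo P? f {n = zero}  z≤n _ _ = refl
length-takeWhile-applyUpTo P? f {n = suc n} z≤n _ ¬Pf0 rewrite dec-false (P? (f 0)) ¬Pf0 = refl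
length-takeWhile-applyUpTo P? f (s≤s m≤n) Pf ¬Pfm rewrite dec-true (P? (f 0)) (Pf (s≤s z≤n)) =
  cong suc (length-takeWhile-applyUpTo P? (f ∘ suc) m≤n (Pf ∘ s≤s) ¬Pfm)

distance-unique : ∀ (G : Graph N) {u w d} → d ≤ N → Walk G d u w →
                  (∀ {e} → Walk G e u w → d ≤ e) → distance G u w ≡ d
distance-unique G {u} {w} d≤N walk shortest = length-takeWhile-applyUpTo
  (λ d → ¬? (walk? G d u w)) id d≤N (λ e<d walk′ → ℕ.<⇒≱ e<d (shortest walk′)) (λ ¬walk → ¬walk walk)

module _ {N : ℕ} where

  ascend : ∀ d {u w : Fin N} → toℕ w ≡ d + toℕ u → Walk (path N) d u w
  ascend zero w≡u = subst (Walk _ 0 _) (sym (Fin.toℕ-injective w≡u)) []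
  ascend (suc d) {u} {w} w≡ = inj₁ v≡ ∷ ascend d (trans w≡ (trans (sym (ℕ.+-suc d (toℕ u))) (cong (λ l → d + l) (sym v≡))))
    where
    v<N : suc (toℕ u) < N
    v<N = ℕ.≤-<-trans (ℕ.≤-trans (s≤s (ℕ.m≤n+m (toℕ u) d)) (ℕ.≤-reflexive (sym w≡))) (Fin.toℕ<n w)
    v≡ = Fin.toℕ-fromℕ< v<N

  descend : ∀ d {u w : Fin N} → toℕ u ≡ d + toℕ w → Walk (path N) d u w
  descend zero u≡w = subst (Walk _ 0 _) (Fin.toℕ-injective u≡w) []
  descend (suc d) {u} {w} u≡ = inj₂ (trans u≡ (cong suc (sym v≡))) ∷ descend d v≡
    where
    v<N : d + toℕ w < N
    v<N = subst (_≤ N) u≡ (ℕ.<⇒≤ (Fin.toℕ<n u))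
    v≡ = Fin.toℕ-fromℕ< v<N

  -- Each edge changes the index by one; the triangle inequality sums this up.
  walk-length : ∀ {d} {u w : Fin N} → Walk (path N) d u w → ∣ toℕ u - toℕ w ∣ ≤ d
  walk-length {u = u} [] = ℕ.≤-reflexive (ℕ.∣n-n∣≡0 (toℕ u))
  walk-length {suc d} {u} {w} (_∷_ {v = v} adj walk) = ℕ.≤-trans
    (ℕ.∣-∣-triangle (toℕ u) (toℕ v) (toℕ w)) (ℕ.+-mono-≤ (ℕ.≤-reflexive (step adj)) (walk-length walk))
    where
    step : Adj (path N) u v → ∣ toℕ u - toℕ v ∣ ≡ 1
    step (inj₁ v≡) rewrite v≡ = trans (ℕ.m≤n⇒∣m-n∣≡n∸m (ℕ.n≤1+n (toℕ u))) (ℕ.m+n∸n≡m 1 (toℕ u))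
    step (inj₂ u≡) rewrite u≡ = trans (ℕ.m≤n⇒∣n-m∣≡n∸m (ℕ.n≤1+n (toℕ v))) (ℕ.m+n∸n≡m 1 (toℕ v))

  distance-path : ∀ (u w : Fin N) → distance (path N) u w ≡ ∣ toℕ u - toℕ w ∣
  distance-path u w = distance-unique (path N)
    (ℕ.≤-trans (ℕ.∣m-n∣≤m⊔n (toℕ u) (toℕ w)) (ℕ.⊔-lub (ℕ.<⇒≤ (Fin.toℕ<n u)) (ℕ.<⇒≤ (Fin.toℕ<n w))))
    shortest walk-length
    where
    shortest : Walk (path N) ∣ toℕ u - toℕ w ∣ u w
    shortest with ℕ.≤-total (toℕ u) (toℕ w)
    ... | inj₁ u≤w = ascend _ (sym (trans (cong (_+ toℕ u) (ℕ.m≤n⇒∣m-n∣≡n∸m u≤w)) (ℕ.m∸n+n≡m u≤w)))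
    ... | inj₂ w≤u = descend _ (sym (trans (cong (_+ toℕ w) (ℕ.m≤n⇒∣n-m∣≡n∸m w≤u)) (ℕ.m∸n+n≡m w≤u)))

-- The zigzag inside an access graph

tabulate-∷ʳ : ∀ {A : Set} {n} (f : Fin (suc n) → A) → tabulate f ≡ tabulate (f ∘ inject₁) ∷ʳ f (fromℕ n)
tabulate-∷ʳ {n = zero}  f = refl
tabulate-∷ʳ {n = suc n} f = cong (f zero ∷_) (tabulate-∷ʳ (f ∘ suc))

Linked-tabulate : ∀ {A : Set} {R : Rel A 0ℓ} {n} (f : Fin (suc n) → A) →
                  (∀ i → R (f (inject₁ i)) (f (suc i))) → Linked R (tabulate f)
Linked-tabulate {n = zero}  f r = [-]
Linked-tabulate {n = suc n} f r = r zero ∷ Linked-tabulate (f ∘ suc) (r ∘ suc)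

interior : ∀ {A : Set} {n} → (Fin (suc (suc n)) → A) → List A
interior f = tabulate (f ∘ suc ∘ inject₁)

interior-ends : ∀ {A : Set} {n} (f : Fin (suc (suc n)) → A) →
                tabulate f ≡ f zero ∷ interior f ∷ʳ f (fromℕ (suc n))
interior-ends f = cong (f zero ∷_) (tabulate-∷ʳ (f ∘ suc))

Request : Graph N → Rel (Fin N) 0ℓ
Request G p q = p ≡ q ⊎ Adj G p q

Request-sym : (G : Graph N) → Symmetric (Request G)
Request-sym G (inj₁ p≡q) = inj₁ (sym p≡q)
Request-sym G (inj₂ adj) = inj₂ (adj-sym G adj)

module _ (G : Graph N) (contains : Contains G (path (suc (suc k)))) where
  private
    f = proj₁ contains
    f-injective = proj₁ (proj₂ contains)
    f-adj = proj₂ (proj₂ contains)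
    first = f zero
    inner = interior f
    final = f (fromℕ (suc k))

  Contains⇒Course : Course (suc k) first inner final
  Contains⇒Course = record
    { distinct = subst Unique (interior-ends f) (Unique.tabulate⁺ f-injective)
    ; size     = cong suc (List.length-tabulate (f ∘ suc ∘ inject₁))
    }

  zigzag-respects : ∀ m → Respects G (zigzag m first inner final)
  zigzag-respects m = Linked-zigzag (Request-sym G) m (subst (Linked _) (interior-ends f)
    (Linked-tabulate f λ i → inj₂ (f-adj (inj₁ (cong suc (sym (Fin.toℕ-inject₁ i)))))))

  alternating-requests : (A : Algorithm N) → (∀ m → faults A (zigzag (suc m) first inner final) ≡ suc k + m) →
    ∀ m → ∃[ I ] Respects G I × length I ≡ suc m * suc k
               × faults (FWF (suc k)) I ≡ suc m * suc k × faults A I ≡ suc k + m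
  alternating-requests A A≡ m = zigzag (suc m) first inner final , zigzag-respects (suc m)
    , trans (length-zigzag (suc m) first inner final) (cong (suc m *_) (Course.size Contains⇒Course))
    , FWF-zigzag m Contains⇒Course
    , A≡ m

path-contains : m ≤ n → Contains (path n) (path m)
path-contains m≤n = (λ i → inject≤ i m≤n) , Fin.inject≤-injective m≤n m≤n _ _ , λ {u} {v} → adj u v
  where
  adj : ∀ u v → Adj (path _) u v → Adj (path _) (inject≤ u m≤n) (inject≤ v m≤n)
  adj u v uv rewrite Fin.toℕ-inject≤ u m≤n | Fin.toℕ-inject≤ v m≤n = uv

-- Distances in all of `path N` are differences of indices, and the zigzag runs on an initial
-- segment, whose ends have extreme indices.
path-Farthest : (k<N : suc (suc k) ≤ N) → let f = λ i → inject≤ i k<N in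
                Farthest (path N) (f zero) (interior f) (f (fromℕ (suc k)))
path-Farthest {k} k<N = record
  { from-y = All.tabulate⁺ λ i → from-zero (suc (inject₁ i))
  ; from-z = All.tabulate⁺ λ i → from-last (suc (inject₁ i))
  }
  where
  f = λ i → inject≤ i k<N
  last = fromℕ (suc k)

  distance-f : ∀ i j → distance (path _) (f i) (f j) ≡ ∣ toℕ i - toℕ j ∣
  distance-f i j rewrite distance-path (f i) (f j) | Fin.toℕ-inject≤ i k<N | Fin.toℕ-inject≤ j k<N = refl

  i≤last : ∀ i → toℕ i ≤ toℕ last
  i≤last i rewrite Fin.toℕ-fromℕ (suc k) = Fin.toℕ≤pred[n] i

  from-zero : ∀ i → distance (path _) (f i) (f zero) ≤ distance (path _) (f last) (f zero)
  from-zero i rewrite distance-f i zero | distance-f last zero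
    | ℕ.∣-∣-identityʳ (toℕ i) | ℕ.∣-∣-identityʳ (toℕ last) = i≤last i

  from-last : ∀ i → distance (path _) (f i) (f last) ≤ distance (path _) (f zero) (f last)
  from-last i rewrite distance-f i last | distance-f zero last =
    ℕ.≤-trans (ℕ.∣m-n∣≤m⊔n (toℕ i) (toℕ last)) (ℕ.⊔-lub (i≤last i) ℕ.≤-refl)

-- Existence of the maximum

words : ∀ N → ℕ → List (List (Fin N))
words N zero    = [ [] ]
words N (suc n) = cartesianProductWith _∷_ (allFin N) (words N n)

∈-words⁺ : ∀ (I : List (Fin N)) → I ∈ words N (length I)
∈-words⁺ []      = here refl
∈-words⁺ (p ∷ I) = ∈-cartesianProductWith⁺ _∷_ (∈-allFin p) (∈-words⁺ I)

∈-words⁻ : ∀ n {I : List (Fin N)} → I ∈ words N n → length I ≡ n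
∈-words⁻ zero (here refl) = refl
∈-words⁻ {N} (suc n) I∈ with ∈-cartesianProductWith⁻ _∷_ (allFin N) (words N n) I∈
... | _ , _ , _ , J∈ , refl = cong suc (∈-words⁻ n J∈)

-- There are finitely many words of length `n` and `P` is decidable, so `argmax` can search them;
-- the given word serves as its default.
maximum-exists : ∀ {P : Pred (List (Fin N)) 0ℓ} (P? : Decidable P) (g : List (Fin N) → ℤ) n →
  ∃[ I ] P I × length I ≡ n →
  ∃[ I ] P I × length I ≡ n × (∀ J → P J → length J ≡ n → g J ℤ.≤ g I)
maximum-exists {N} {P} P? g n (I₀ , PI₀ , I₀≡n) = argmax g I₀ candidates , proj₁ valid , proj₂ valid , maximal
  where
  candidates = filter P? (words N n)

  valid : P (argmax g I₀ candidates) × length (argmax g I₀ candidates) ≡ n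
  valid = argmax-all g (PI₀ , I₀≡n) (All.tabulate λ I∈ →
    let I∈words , PI = ∈-filter⁻ P? I∈ in PI , ∈-words⁻ n I∈words)

  maximal : ∀ J → P J → length J ≡ n → g J ℤ.≤ g (argmax g I₀ candidates)
  maximal J PJ refl = All.lookup (f[xs]≤f[argmax] {f = g} I₀ candidates) (∈-filter⁺ P? (∈-words⁺ J) PJ)

respects? : (G : Graph N) → Decidable (Respects G)
respects? G = linked? λ p q → (p Fin.≟ q) ⊎-dec adj? G p q

-- Bounds on the difference of faults

Respects-replicate : (G : Graph N) → ∀ n v → Respects G (replicate n v)
Respects-replicate G zero          v = []
Respects-replicate G (suc zero)    v = [-]
Respects-replicate G (suc (suc n)) v = inj₁ refl ∷ Respects-replicate G (suc n) v

FWF-replicate : ∀ n (v : Fin N) → faults (FWF (suc k)) (replicate (suc n) v) ≡ 1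
FWF-replicate {k = k} n v = cong suc (all-hits n)
  where
  all-hits : ∀ n → faultsFrom (FWF (suc k)) [ v ] (replicate n v) ≡ 0
  all-hits zero    = refl
  all-hits (suc n) = trans (faults-hit (FWF (suc k)) {s = [ v ]} {p = v} (replicate n v) (here refl))
    (trans (cong (λ c → faultsFrom (FWF (suc k)) c (replicate n v))
                 (FWF-hit {p = v} {c = [ v ]} {k = suc k} (here refl)))
           (all-hits n))

module _ {A : Algorithm N} (D : Dominated (suc k) A) where
  open Dominated D

  replicate-faults : ∀ n v → faults A (replicate n v) ≡ faults (FWF (suc k)) (replicate n v)
  replicate-faults zero    v = refl
  replicate-faults (suc n) v = ℕ.≤-antisym (faultsFrom-≤ D (replicate (suc n) v) initially) (begin
    faults (FWF (suc k)) (replicate (suc n) v)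
      ≡⟨ FWF-replicate n v ⟩
    1
      ≤⟨ s≤s z≤n ⟩
    suc (faultsFrom A (serve A v (initial A)) (replicate n v))
      ≡⟨ faults-miss A (replicate n v) (∉[] ∘ subst (v ∈_) empty) ⟨
    faults A (replicate (suc n) v) ∎)
    where
    open ℕ.≤-Reasoning
    ∉[] : v ∉ []
    ∉[] ()

  -- Of the `suc k` copies of FWF's faults, one is bounded by `phase-bound` and the other `k` by the
  -- number of requests.
  difference-bound : ∀ I → suc k * faults (FWF (suc k)) I ≤ k * length I + suc k + suc k * faults A I
  difference-bound I = begin
    F + k * F
      ≤⟨ ℕ.+-mono-≤ F≤ (ℕ.*-monoʳ-≤ k (faultsFrom-≤-length (FWF (suc k)) I)) ⟩
    (suc k * faults A I + suc k) + k * length I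
      ≡⟨ ℕ.+-comm _ (k * length I) ⟩
    k * length I + (suc k * faults A I + suc k)
      ≡⟨ cong (λ l → k * length I + l) (ℕ.+-comm (suc k * faults A I) (suc k)) ⟩
    k * length I + (suc k + suc k * faults A I)
      ≡⟨ ℕ.+-assoc (k * length I) (suc k) _ ⟨
    k * length I + suc k + suc k * faults A I ∎
    where
    open ℕ.≤-Reasoning
    F = faults (FWF (suc k)) I
    F≤ : F ≤ suc k * faults A I + suc k
    F≤ = subst (_≤ suc k * faults A I + suc k) (ℕ.+-identityʳ F) (phase-bound D I initially)

-- Averages and limits

cross-≤ : ∀ a b c d → a + d ≤ c + b → + a ℤ.- + b ℤ.≤ + c ℤ.- + d
cross-≤ a b c d a+d≤c+b = begin
  + a ℤ.- + b                            ≡⟨ cancel (+ a) (+ b) (+ d) ⟩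
  + (a + d) ℤ.+ ℤ.- (+ b ℤ.+ + d)        ≤⟨ ℤ.+-monoˡ-≤ (ℤ.- (+ b ℤ.+ + d)) (ℤ.+≤+ a+d≤c+b) ⟩
  + (c + b) ℤ.+ ℤ.- (+ b ℤ.+ + d)        ≡⟨ cong (λ i → + (c + b) ℤ.+ ℤ.- i) (ℤ.+-comm (+ b) (+ d)) ⟩
  + (c + b) ℤ.+ ℤ.- (+ d ℤ.+ + b)        ≡⟨ cancel (+ c) (+ d) (+ b) ⟨
  + c ℤ.- + d                            ∎
  where
  open ℤ.≤-Reasoning
  cancel : ∀ i j l → i ℤ.- j ≡ i ℤ.+ l ℤ.+ ℤ.- (j ℤ.+ l)
  cancel = solve 3 (λ i j l → i :- j := i :+ l :+ :- (j :+ l)) refl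
    where open ℤSolver

toℚᵘ-/ : ∀ i n → ℚ.toℚᵘ (i / suc n) ℚᵘ.≃ mkℚᵘ i n
toℚᵘ-/ i n = ℚ.toℚᵘ-fromℚᵘ (mkℚᵘ i n)

1-1/k : ∀ k → 1ℚ - + 1 / suc k ≡ + k / suc k
1-1/k k = ℚ.toℚᵘ-injective (begin
  ℚ.toℚᵘ (1ℚ - + 1 / suc k)               ≈⟨ ℚ.toℚᵘ-homo-+ 1ℚ (ℚ.- (+ 1 / suc k)) ⟩
  ℚᵘ.1ℚᵘ ℚᵘ.+ ℚ.toℚᵘ (ℚ.- (+ 1 / suc k))  ≈⟨ ℚᵘ.+-congʳ ℚᵘ.1ℚᵘ (ℚ.toℚᵘ-homo‿- (+ 1 / suc k)) ⟩
  ℚᵘ.1ℚᵘ ℚᵘ.- ℚ.toℚᵘ (+ 1 / suc k)        ≈⟨ ℚᵘ.+-congʳ ℚᵘ.1ℚᵘ (ℚᵘ.-‿cong (toℚᵘ-/ (+ 1) k)) ⟩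
  ℚᵘ.1ℚᵘ ℚᵘ.- mkℚᵘ (+ 1) k                ≈⟨ *≡* (cong₂ ℤ._*_ numerator (cong +_ (sym (ℕ.*-identityˡ (suc k))))) ⟩
  mkℚᵘ (+ k) k                            ≈⟨ toℚᵘ-/ (+ k) k ⟨
  ℚ.toℚᵘ (+ k / suc k)                    ∎)
  where
  open import Relation.Binary.Reasoning.Setoid ℚᵘ.≃-setoid
  numerator : + 1 ℤ.* + suc k ℤ.+ ℤ.- (+ 1) ℤ.* + 1 ≡ + k
  numerator = cong (ℤ._+ ℤ.- (+ 1)) (ℤ.*-identityˡ (+ suc k))

average-≤ : ∀ k n M → M ℤ.* + suc k ℤ.≤ + k ℤ.* + suc n ℤ.+ + suc k →
            M / suc n ℚ.≤ + k / suc k ℚ.+ + 1 / suc n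
average-≤ k n M M≤ = ℚ.toℚᵘ-cancel-≤ (begin
  ℚ.toℚᵘ (M / suc n)                                   ≃⟨ toℚᵘ-/ M n ⟩
  mkℚᵘ M n                                             ≤⟨ *≤* cross ⟩
  mkℚᵘ (+ k) k ℚᵘ.+ mkℚᵘ (+ 1) n                       ≃⟨ ℚᵘ.+-cong (toℚᵘ-/ (+ k) k) (toℚᵘ-/ (+ 1) n) ⟨
  ℚ.toℚᵘ (+ k / suc k) ℚᵘ.+ ℚ.toℚᵘ (+ 1 / suc n)       ≃⟨ ℚ.toℚᵘ-homo-+ (+ k / suc k) (+ 1 / suc n) ⟨
  ℚ.toℚᵘ (+ k / suc k ℚ.+ + 1 / suc n)                 ∎)
  where
  open ℚᵘ.≤-Reasoning
  -- Unnormalised sums keep the product of the denominators, so this is the hypothesis times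
  -- `suc n`.
  cross : M ℤ.* + (suc k * suc n) ℤ.≤ (+ k ℤ.* + suc n ℤ.+ + 1 ℤ.* + suc k) ℤ.* + suc n
  cross rewrite ℤ.pos-* (suc k) (suc n) | ℤ.*-identityˡ (+ suc k) | sym (ℤ.*-assoc M (+ suc k) (+ suc n)) =
    ℤ.*-monoʳ-≤-nonNeg (+ suc n) M≤

average-≥ : ∀ k m M → + k ℤ.* + suc m ℤ.- + suc k ℤ.≤ M →
            + k / suc k - + 1 / suc m ℚ.≤ M / (suc m * suc k)
average-≥ k m M ≤M = ℚ.toℚᵘ-cancel-≤ (begin
  ℚ.toℚᵘ (+ k / suc k - + 1 / suc m)                          ≃⟨ ℚ.toℚᵘ-homo-+ (+ k / suc k) (ℚ.- (+ 1 / suc m)) ⟩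
  ℚ.toℚᵘ (+ k / suc k) ℚᵘ.+ ℚ.toℚᵘ (ℚ.- (+ 1 / suc m))        ≃⟨ ℚᵘ.+-cong (toℚᵘ-/ (+ k) k) (ℚᵘ.≃-trans (ℚ.toℚᵘ-homo‿- (+ 1 / suc m)) (ℚᵘ.-‿cong (toℚᵘ-/ (+ 1) m))) ⟩
  mkℚᵘ (+ k) k ℚᵘ.- mkℚᵘ (+ 1) m                              ≤⟨ *≤* cross ⟩
  mkℚᵘ M (k + m * suc k)                                      ≃⟨ toℚᵘ-/ M (k + m * suc k) ⟨
  ℚ.toℚᵘ (M / (suc m * suc k))                                ∎)
  where
  open ℚᵘ.≤-Reasoning
  cross : (+ k ℤ.* + suc m ℤ.+ ℤ.- (+ 1) ℤ.* + suc k) ℤ.* + (suc m * suc k) ℤ.≤ M ℤ.* + (suc k * suc m)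
  cross rewrite ℤ.-1*i≡-i (+ suc k) | ℕ.*-comm (suc m) (suc k) =
    ℤ.*-monoʳ-≤-nonNeg (+ (suc k * suc m)) ≤M

archimedean : ∀ ε → 0ℚ ℚ.< ε → ∃[ d ] ∀ n → d ≤ n → + 1 / suc n ℚ.< ε
-- The numerator is at least 1, so the denominator `suc d` of `ε` is a valid threshold.
archimedean (ℚ.mkℚ (+ suc a) d c) _ = suc d , λ n d<n → ℚ.toℚᵘ-cancel-< (begin-strict
  ℚ.toℚᵘ (+ 1 / suc n)  ≃⟨ toℚᵘ-/ (+ 1) n ⟩
  mkℚᵘ (+ 1) n          <⟨ *<* (cross n d<n) ⟩
  mkℚᵘ (+ suc a) d      ∎)
  where
  open ℚᵘ.≤-Reasoning
  cross : ∀ n → suc d ≤ n → + 1 ℤ.* + suc d ℤ.< + suc a ℤ.* + suc n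
  cross n d<n rewrite ℤ.*-identityˡ (+ suc d) | sym (ℤ.pos-* (suc a) (suc n)) =
    ℤ.+<+ (ℕ.≤-trans (s≤s d<n) (ℕ.m≤m+n (suc n) (a * suc n)))
archimedean (ℚ.mkℚ (+ zero) d c)     (ℚ.*<* (ℤ.+<+ ()))
archimedean (ℚ.mkℚ ℤ.-[1+ a ] d c) (ℚ.*<* ())

liminf-zero : IsLiminf (λ n → 0ℤ / suc n) 0ℚ
liminf-zero ε 0<ε =
  (0 , λ n _ → subst (0ℚ - ε ℚ.<_) (sym (ℚ.0/n≡0 (suc n))) 0-ε<0)
  , λ n₀ → n₀ , ℕ.≤-refl , subst (ℚ._< 0ℚ ℚ.+ ε) (sym (ℚ.0/n≡0 (suc n₀))) (subst (0ℚ ℚ.<_) (sym (ℚ.+-identityˡ ε)) 0<ε)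
  where
  0-ε<0 : 0ℚ - ε ℚ.< 0ℚ
  0-ε<0 = subst (0ℚ - ε ℚ.<_) (ℚ.+-identityʳ 0ℚ) (ℚ.+-monoʳ-< 0ℚ (ℚ.neg-antimono-< 0<ε))

limsup-average : ∀ k (M : ℕ → ℤ) →
  (∀ n → M n ℤ.* + suc k ℤ.≤ + k ℤ.* + n ℤ.+ + suc k) →
  (∀ m → + k ℤ.* + suc m ℤ.- + suc k ℤ.≤ M (suc m * suc k)) →
  IsLimsup (λ n → M (suc n) / suc n) (1ℚ - + 1 / suc k)
limsup-average k M M≤ ≤M ε 0<ε rewrite 1-1/k k =
  (d , λ n d≤n → ℚ.≤-<-trans (average-≤ k n (M (suc n)) (M≤ (suc n)))
                              (ℚ.+-monoʳ-< (+ k / suc k) (1/n<ε n d≤n)))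
  -- The summand `n₀` makes the index large and `d` makes the error smaller than `ε`. The index is
  -- the predecessor of `suc m * suc k`, since the averages start at 1.
  , λ n₀ → let m = n₀ + d in
      k + m * suc k
    , ℕ.≤-trans (ℕ.m≤m+n n₀ d) (ℕ.≤-trans (ℕ.m≤m*n m (suc k)) (ℕ.m≤n+m (m * suc k) k))
    , ℚ.<-≤-trans (ℚ.+-monoʳ-< (+ k / suc k) (ℚ.neg-antimono-< (1/n<ε m (ℕ.m≤n+m d n₀))))
                  (average-≥ k m (M (suc m * suc k)) (≤M m))
  where
  d = proj₁ (archimedean ε 0<ε)
  1/n<ε = proj₂ (archimedean ε 0<ε)

-- The relative intervals

module _ (G : Graph N) {A : Algorithm N} (D : Dominated (suc k) A) (v : Fin N)
         (alternate : ∀ m → ∃[ I ] Respects G I × length I ≡ suc m * suc k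
                          × faults (FWF (suc k)) I ≡ suc m * suc k × faults A I ≡ suc k + m) where
  private
    difference : List (Fin N) → ℤ
    difference I = + faults (FWF (suc k)) I ℤ.- + faults A I

    constant : ∀ n → ∃[ I ] Respects G I × length I ≡ n
    constant n = replicate n v , Respects-replicate G n v , List.length-replicate n

    best : ∀ n → ∃[ I ] Respects G I × length I ≡ n × (∀ J → Respects G J → length J ≡ n → difference J ℤ.≤ difference I)
    best n = maximum-exists (respects? G) difference n (constant n)

    Max : ℕ → ℤ
    Max n = difference (proj₁ (best n))

  relativeInterval : RelativeInterval G (FWF (suc k)) A 0ℚ (1ℚ - + 1 / suc k)
  relativeInterval = record
    { Min        = λ _ → 0ℤ
    ; Max        = Max
    ; Min-min    = λ n →
        ( replicate n v , Respects-replicate G n v , List.length-replicate n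
        , sym (ℤ.i≡j⇒i-j≡0 (cong (λ l → + l) (sym (replicate-faults D n v)))))
        , λ { x (I , _ , _ , refl) → ℤ.i≤j⇒0≤j-i (ℤ.+≤+ (faultsFrom-≤ D I (Dominated.initially D))) }
    ; Max-max    = λ n → let I , respects , I≡n , maximal = best n in
        (I , respects , I≡n , refl) , λ { x (J , J-respects , J≡n , refl) → maximal J J-respects J≡n }
    ; Min-liminf = liminf-zero
    ; Max-limsup = limsup-average k Max upper lower
    }
    where
    upper : ∀ n → Max n ℤ.* + suc k ℤ.≤ + k ℤ.* + n ℤ.+ + suc k
    upper n = let I , _ , I≡n , _ = best n in bound I I≡n
      where
      open ℤ.≤-Reasoning
      bound : ∀ I → length I ≡ n → difference I ℤ.* + suc k ℤ.≤ + k ℤ.* + n ℤ.+ + suc k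
      bound I refl = begin
        (+ F ℤ.- + F′) ℤ.* + suc k              ≡⟨ distribute (+ F) (+ F′) (+ suc k) ⟩
        + suc k ℤ.* + F ℤ.- + suc k ℤ.* + F′    ≡⟨ cong₂ ℤ._-_ (ℤ.pos-* (suc k) F) (ℤ.pos-* (suc k) F′) ⟨
        + (suc k * F) ℤ.- + (suc k * F′)        ≤⟨ cross-≤ (suc k * F) (suc k * F′) (k * n + suc k) 0
                                                     (subst (_≤ k * n + suc k + suc k * F′) (sym (ℕ.+-identityʳ (suc k * F))) (difference-bound D I)) ⟩
        + (k * n + suc k) ℤ.- + 0               ≡⟨ ℤ.+-identityʳ _ ⟩
        + (k * n) ℤ.+ + suc k                   ≡⟨ cong (ℤ._+ + suc k) (ℤ.pos-* k n) ⟩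
        + k ℤ.* + n ℤ.+ + suc k                 ∎
        where
        F  = faults (FWF (suc k)) I
        F′ = faults A I
        distribute : ∀ i j l → (i ℤ.- j) ℤ.* l ≡ l ℤ.* i ℤ.- l ℤ.* j
        distribute = solve 3 (λ i j l → (i :- j) :* l := l :* i :- l :* j) refl
          where open ℤSolver

    lower : ∀ m → + k ℤ.* + suc m ℤ.- + suc k ℤ.≤ Max (suc m * suc k)
    lower m = let I , respects , I≡n , F≡ , F′≡ = alternate m in begin
      + k ℤ.* + suc m ℤ.- + suc k              ≡⟨ cong (ℤ._- + suc k) (ℤ.pos-* k (suc m)) ⟨
      -- The zigzag's difference is exactly `k * m`, one more than the left side; the slack gives
      -- the form that `average-≥` divides evenly.
      + (k * suc m) ℤ.- + suc k                ≤⟨ cross-≤ (k * suc m) (suc k) (suc m * suc k) (suc k + m) (arithmetic m) ⟩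
      + (suc m * suc k) ℤ.- + (suc k + m)      ≡⟨ cong₂ (λ a b → + a ℤ.- + b) F≡ F′≡ ⟨
      difference I                             ≤⟨ proj₂ (proj₂ (proj₂ (best (suc m * suc k)))) I respects I≡n ⟩
      Max (suc m * suc k)                      ∎
      where
      open ℤ.≤-Reasoning
      arithmetic : ∀ m → k * suc m + (suc k + m) ≤ suc m * suc k + suc k
      arithmetic m = subst₂ _≤_ (rearrange k m) refl (ℕ.+-monoʳ-≤ (suc m * suc k) (ℕ.n≤1+n k))
        where
        rearrange : ∀ k m → suc m * suc k + k ≡ k * suc m + (suc k + m)
        rearrange = solve 2 (λ k m → (con 1 :+ m) :* (con 1 :+ k) :+ k := k :* (con 1 :+ m) :+ ((con 1 :+ k) :+ m)) refl
          where open ℕSolver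

LRU-interval : (G : Graph N) → Contains G (path (suc (suc k))) →
               RelativeInterval G (FWF (suc k)) (LRU (suc k)) 0ℚ (1ℚ - + 1 / suc k)
LRU-interval {k = k} G contains = relativeInterval G (LRU-dominated (s≤s z≤n)) (proj₁ contains zero)
  (alternating-requests G contains (LRU (suc k)) λ m →
    faults-zigzag LRU-movesToFront (λ _ _ _ → ⊤) _ (λ course _ → LRU-turn course)
      m (Contains⇒Course G contains) _)

FAR-interval : suc (suc k) ≤ N →
               RelativeInterval (path N) (FWF (suc k)) (FAR (suc k) (path N)) 0ℚ (1ℚ - + 1 / suc k)
FAR-interval {k = k} {N = N} k<N = relativeInterval (path N) (FAR-dominated (s≤s z≤n) (path N)) (proj₁ contains zero)
  (alternating-requests (path N) contains (FAR (suc k) (path N)) λ m →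
    faults-zigzag (FAR-movesToFront (path N)) (Farthest (path N)) Farthest-flip (FAR-turn (path N))
      m (Contains⇒Course (path N) contains) (path-Farthest k<N))
  where contains = path-contains k<N

theorem2 : (k : ℕ) .{{_ : NonZero k}} →
    ((N : ℕ) → suc k ≤ N →
    RelativeInterval (path N) (FWF k) (LRU k) 0ℚ (1ℚ - + 1 / k)
    × RelativeInterval (path N) (FWF k) (FAR k (path N)) 0ℚ (1ℚ - + 1 / k))
    × ((N : ℕ) (G : Graph N) → Contains G (path (suc k)) →
    RelativeInterval G (FWF k) (LRU k) 0ℚ (1ℚ - + 1 / k))
theorem2 (suc k) =
  (λ N k<N → LRU-interval (path N) (path-contains k<N) , FAR-interval k<N) , λ N G contains → LRU-interval G contains
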